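{- Let $p\ge 5$ be a prime with $p\equiv 3\pmod 4$ and let $m,\alpha,\beta\ge 1$ be integers with $2\nmid\alpha$. Then for all integers $n,k\ge 0$ with $p\nmid n$, $$\bar a_{2^m\alpha}\left(4p^{2k+1}n+p^{2k+2}\right)\equiv 0\pmod{2^{m+2}},$$ $$\bar a_{2\beta+1}\left(4p^{2k+1}n+p^{2k+2}\right)\equiv 0\pmod 4.$$
   Context: For integers $\ell\ge1$ write $f_\ell=\prod_{j\ge 1}(1-q^{\ell j})$. For a positive integer $s$, $\bar a_s(n)$ denotes the number of partitions of $n$ in which each odd part occurs in one of $s$ colors and the first occurrence of each part (parts of the same size but different colors being distinct) may be overlined. Equivalently, $$\sum_{n\ge0}\bar a_s(n)q^n=\frac{f_2^{3s-2}}{f_1^{2s}f_4^{s-1}}.$$ -}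

module Defs where

open import Data.Bool using (Bool; true; false; if_then_else_)
open import Data.Bool.Properties using () renaming (_≟_ to _≟ᵇ_)
open import Data.List using (List; []; _∷_; length; map; upTo; filter; concatMap; cartesianProductWith)
open import Data.List.Relation.Unary.Linked using (Linked; linked?)
open import Data.Nat using (ℕ; zero; suc; _<_; _<?_; _≟_)
open import Data.Nat.Divisibility using (_∣?_)
open import Data.Nat.ListAction using (sum)
open import Data.Product using (_×_)
open import Data.Sum using (_⊎_)
open import Relation.Binary.PropositionalEquality using (_≡_)
open import Relation.Nullary using (Dec; does)
open import Relation.Nullary.Decidable using (_×-dec_; _⊎-dec_)

-- Colours are numbered from 0.
record Part : Set where
  constructor part
  field
    size      : ℕ
    colour    : ℕ
    overlined : Bool

open Part public

colours : ℕ → ℕ → ℕ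
colours s j = if does (2 ∣? j) then 1 else s

-- All admissible parts of size 1, …, n, each listed once.
parts : ℕ → ℕ → List Part
parts s n =
  concatMap (λ j →
  concatMap (λ c → part j c false ∷ part j c true ∷ [])
    (upTo (colours s j)))
    (map suc (upTo n))

-- y may stand directly after x.  A partition is written with its parts
-- decreasing lexicographically in (size , colour), so that equal parts of the
-- same colour are adjacent; among these only the first may be overlined.
_▷_ : Part → Part → Set
x ▷ y = size y < size x
      ⊎ (size y ≡ size x × colour y < colour x)
      ⊎ (size y ≡ size x × colour y ≡ colour x × overlined y ≡ false)

_▷?_ : ∀ x y → Dec (x ▷ y)
x ▷? y = (size y <? size x)
   ⊎-dec ((size y ≟ size x) ×-dec (colour y <? colour x))
   ⊎-dec ((size y ≟ size x) ×-dec (colour y ≟ colour x) ×-dec (overlined y ≟ᵇ false))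

-- For a list whose entries are admissible parts, that is, members of parts s n.
IsOverpartition : ℕ → List Part → Set
IsOverpartition n xs = Linked _▷_ xs × sum (map size xs) ≡ n

isOverpartition? : ∀ n xs → Dec (IsOverpartition n xs)
isOverpartition? n xs = linked? _▷?_ xs ×-dec (sum (map size xs) ≟ n)

-- All lists of length at most the given number with entries from a given
-- list, each listed once if the entries are distinct.
words : ∀ {A : Set} → ℕ → List A → List (List A)
words zero    as = [] ∷ []
words (suc l) as = [] ∷ cartesianProductWith _∷_ as (words l as)

-- A partition of n has at most n parts, each of size at most n, so the
-- candidates below include every overpartition.
overpartitions : ℕ → ℕ → List (List Part)
overpartitions s n = filter (isOverpartition? n) (words n (parts s n))

ā : ℕ → ℕ → ℕ
ā s n = length (overpartitions s n)

{-# OPTIONS --safe #-}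

-- The generating function of ā s is the product over j ≥ 1 of c_j copies of
-- T_j = (1 + q^j) / (1 - q^j) = 1 + 2 X_j, where X_j = q^j / (1 - q^j), c_j = s for odd j and
-- c_j = 1 for even j.  Since T_j² = 1 + 4 Y_j with Y_j = X_j + X_j², repeated squaring gives
-- T_j^(2^m α) ≡ 1 + 2^(m+1) α Y_j modulo 2^(m+2).  For s = 2^m α the product is therefore
-- e + 2^(m+1) u modulo 2^(m+2), where e is the contribution of the even parts, an even series
-- with e ≡ 1 modulo 2, and u ≡ α Σ_{j odd} Y_j modulo 2.  At an odd exponent N the series e
-- vanishes, X_j² is even, and Σ_j X_j counts the divisors of N.  For odd s the product is
-- 1 + 2 Σ_j X_j modulo 4.  Finally N = p^(2k+1) (4n + p) is odd and not a square, so it has an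
-- even number of divisors.
module Submission where

open import Defs
open import Data.Bool using (true; false; if_then_else_)
open import Data.List using (List; []; _∷_; _++_; length; map; upTo; filter; concatMap; cartesianProductWith)
open import Data.List.Properties using (length-++; filter-++; map-++; map-∘; map-cong; upTo-∷ʳ; filter-≐; filter-none)
open import Data.List.Relation.Unary.All using (universal)
open import Data.List.Relation.Unary.Linked as Linked using (Linked; _∷_; linked?)
open import Data.Nat using (ℕ; zero; suc; _+_; _*_; _^_; _≤_; _<_; z≤n; s≤s; _≟_; _≥_; _%_; _/_)
open import Data.Nat.Divisibility
open import Data.Nat.DivMod using (m≡m%n+[m/n]*n)
open import Data.Nat.ListAction using (sum)
open import Data.Nat.ListAction.Properties using (sum-++)
open import Data.Nat.Primality using (Prime; prime[2]; euclidsLemma; prime⇒nonZero)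
open import Data.Nat.Properties hiding (_≟_)
open import Data.Nat.Tactic.RingSolver using (solve-∀)
open import Data.Product using (Σ-syntax; ∃-syntax; _×_; _,_)
open import Data.Sum using (inj₁; inj₂; [_,_]′)
open import Function using (_∘_; id)
open import Level using (0ℓ)
open import Relation.Binary.PropositionalEquality hiding ([_])
open import Relation.Nullary using (Dec; yes; no; does; ¬_; contradiction)
open import Relation.Nullary.Decidable using (dec-true; dec-false; from-no; _×-dec_)
open import Relation.Unary using (Pred; Decidable)

-- Power series, as coefficient sequences

Series : Set
Series = ℕ → ℕ

∑ : ℕ → (ℕ → ℕ) → ℕ
∑ zero    f = 0
∑ (suc n) f = ∑ n f + f n

∑-cong : ∀ n {f g} → (∀ i → i < n → f i ≡ g i) → ∑ n f ≡ ∑ n g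
∑-cong zero    eq = refl
∑-cong (suc n) eq = cong₂ _+_ (∑-cong n (λ i i<n → eq i (m<n⇒m<1+n i<n))) (eq n ≤-refl)

∑-zero : ∀ n {f} → (∀ i → i < n → f i ≡ 0) → ∑ n f ≡ 0
∑-zero zero    eq = refl
∑-zero (suc n) eq = cong₂ _+_ (∑-zero n (λ i i<n → eq i (m<n⇒m<1+n i<n))) (eq n ≤-refl)

∑-truncate : ∀ {m} n {f} → m ≤ n → (∀ i → m ≤ i → f i ≡ 0) → ∑ n f ≡ ∑ m f
∑-truncate {m} n {f} m≤n eq with m≤n⇒m<n∨m≡n m≤n
∑-truncate {m} (suc n) {f} m≤n eq | inj₁ (s≤s m≤n′) = begin
  ∑ n f + f n  ≡⟨ cong₂ _+_ (∑-truncate n m≤n′ eq) (eq n m≤n′) ⟩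
  ∑ m f + 0    ≡⟨ +-identityʳ _ ⟩
  ∑ m f        ∎
  where open ≡-Reasoning
... | inj₂ refl = refl

∑-linear : ∀ n c f g → ∑ n (λ i → f i + c * g i) ≡ ∑ n f + c * ∑ n g
∑-linear zero    c f g = sym (*-zeroʳ c)
∑-linear (suc n) c f g = begin
  ∑ n (λ i → f i + c * g i) + (f n + c * g n)  ≡⟨ cong (_+ (f n + c * g n)) (∑-linear n c f g) ⟩
  ∑ n f + c * ∑ n g + (f n + c * g n)          ≡⟨ ring c (∑ n f) (∑ n g) (f n) (g n) ⟩
  ∑ n f + f n + c * (∑ n g + g n)              ∎
  where
  open ≡-Reasoning
  ring : ∀ c a b x y → a + c * b + (x + c * y) ≡ a + x + c * (b + y)
  ring = solve-∀

∑-+ : ∀ n f g → ∑ n (λ i → f i + g i) ≡ ∑ n f + ∑ n g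
∑-+ n f g = begin
  ∑ n (λ i → f i + g i)      ≡⟨ ∑-cong n (λ i _ → cong (f i +_) (sym (*-identityˡ _))) ⟩
  ∑ n (λ i → f i + 1 * g i)  ≡⟨ ∑-linear n 1 f g ⟩
  ∑ n f + 1 * ∑ n g          ≡⟨ cong (∑ n f +_) (*-identityˡ _) ⟩
  ∑ n f + ∑ n g              ∎
  where open ≡-Reasoning

∑-head : ∀ n f → ∑ (suc n) f ≡ f 0 + ∑ n (f ∘ suc)
∑-head zero    f = sym (+-identityʳ _)
∑-head (suc n) f = trans (cong (_+ f (suc n)) (∑-head n f)) (+-assoc (f 0) _ _)

-- Off the diagonal the terms at `(i , j)` and `(j , i)` agree and pair up. Both parity facts below
-- rest on this: one for the square of `X`, one for the number of divisors.
∑-diagonal : ∀ n (a : ℕ → ℕ → ℕ) → (∀ i j → a i j ≡ a j i) →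
  ∃[ r ] ∑ n (λ i → ∑ n (a i)) ≡ ∑ n (λ i → a i i) + 2 * r
∑-diagonal zero    a a-sym = 0 , refl
∑-diagonal (suc n) a a-sym with ∑-diagonal n a a-sym
-- Enlarging the square adds one row and one column, equal by symmetry, and one diagonal entry.
... | r , eq = r + ∑ n (a n) , (begin
  ∑ n (λ i → ∑ n (a i) + a i n) + (∑ n (a n) + a n n)
    ≡⟨ cong (_+ (∑ n (a n) + a n n)) (∑-+ n (λ i → ∑ n (a i)) (λ i → a i n)) ⟩
  ∑ n (λ i → ∑ n (a i)) + ∑ n (λ i → a i n) + (∑ n (a n) + a n n)
    ≡⟨ cong₂ (λ x y → x + y + (∑ n (a n) + a n n)) eq (∑-cong n (λ i _ → a-sym i n)) ⟩
  ∑ n (λ i → a i i) + 2 * r + ∑ n (a n) + (∑ n (a n) + a n n)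
    ≡⟨ ring (∑ n (λ i → a i i)) r (∑ n (a n)) (a n n) ⟩
  ∑ n (λ i → a i i) + a n n + 2 * (r + ∑ n (a n)) ∎)
  where
  open ≡-Reasoning
  ring : ∀ d r s x → d + 2 * r + s + (s + x) ≡ d + x + 2 * (r + s)
  ring = solve-∀

δ : Series
δ zero    = 1
δ (suc _) = 0

-- Multiplication by q^k, written by recursion so that no truncated subtraction occurs.
shift : ℕ → Series → Series
shift zero    f n       = f n
shift (suc k) f zero    = 0
shift (suc k) f (suc n) = shift k f n

-- Only the index `i` with `k + i ≡ n` matters. Passing this equation on gives callers the bound
-- `i ≤ n`, which truncated sums need.
shift-cong : ∀ k n {f g} → (∀ i → k + i ≡ n → f i ≡ g i) → shift k f n ≡ shift k g n
shift-cong zero    n       eq = eq n refl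
shift-cong (suc k) zero    eq = refl
shift-cong (suc k) (suc n) eq = shift-cong k n (λ i e → eq i (cong suc e))

shift-zero : ∀ k n {f} → (∀ i → k + i ≡ n → f i ≡ 0) → shift k f n ≡ 0
shift-zero zero    n       eq = eq n refl
shift-zero (suc k) zero    eq = refl
shift-zero (suc k) (suc n) eq = shift-zero k n (λ i e → eq i (cong suc e))

shift-> : ∀ {k n} f → n < k → shift k f n ≡ 0
shift-> {k} {n} f n<k = shift-zero k n
  (λ i e → contradiction (≤-trans (m≤m+n k i) (≤-reflexive e)) (<⇒≱ n<k))

shift-shift : ∀ a b f n → shift a (shift b f) n ≡ shift (a + b) f n
shift-shift zero    b f n       = refl
shift-shift (suc a) b f zero    = refl
shift-shift (suc a) b f (suc n) = shift-shift a b f n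

shift-linear : ∀ k c f g n →
  shift k (λ i → f i + c * g i) n ≡ shift k f n + c * shift k g n
shift-linear zero    c f g n       = refl
shift-linear (suc k) c f g zero    = sym (*-zeroʳ c)
shift-linear (suc k) c f g (suc n) = shift-linear k c f g n

shift-+ : ∀ k f g n → shift k (λ i → f i + g i) n ≡ shift k f n + shift k g n
shift-+ zero    f g n       = refl
shift-+ (suc k) f g zero    = refl
shift-+ (suc k) f g (suc n) = shift-+ k f g n

shift-∑ : ∀ k L (f : ℕ → Series) n →
  shift k (λ i → ∑ L (λ t → f t i)) n ≡ ∑ L (λ t → shift k (f t) n)
shift-∑ k zero    f n = shift-zero k n (λ _ _ → refl)
shift-∑ k (suc L) f n = trans (shift-+ k _ (f L) n) (cong (_+ shift k (f L) n) (shift-∑ k L f n))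

-- Multiplication by q^j + q^{2j} + ⋯ + q^{Lj}.
X≤ : ℕ → ℕ → Series → Series
X≤ L j f n = ∑ L (λ t → shift (suc t * j) f n)

-- Multiplication by q^j / (1 - q^j), provided j ≥ 1.
X : ℕ → Series → Series
X j f n = X≤ n j f n

-- A term with `t ≥ n` shifts by more than `n` and contributes nothing.
X≤-stable : ∀ L j f n → n ≤ L → X≤ L (suc j) f n ≡ X (suc j) f n
X≤-stable L j f n n≤L = ∑-truncate L n≤L (λ t n≤t →
  shift-> f (≤-trans (s≤s n≤t) (m≤m*n (suc t) (suc j))))

-- The identity X = q^j (1 + X) for the geometric series. In the counting argument it matches the
-- removal of the first part.
X-unfold : ∀ j f n → X (suc j) f n ≡ shift (suc j) (λ i → f i + X (suc j) f i) n
X-unfold j f n = begin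
  X (suc j) f n
    ≡⟨ X≤-stable (suc n) j f n (n≤1+n n) ⟨
  ∑ (suc n) (λ t → shift (suc t * suc j) f n)
    ≡⟨ ∑-head n _ ⟩
  shift (1 * suc j) f n + ∑ n (λ t → shift (suc j + suc t * suc j) f n)
    ≡⟨ cong₂ _+_ (cong (λ k → shift k f n) (*-identityˡ (suc j)))
                 (∑-cong n (λ t _ → sym (shift-shift (suc j) (suc t * suc j) f n))) ⟩
  shift (suc j) f n + ∑ n (λ t → shift (suc j) (shift (suc t * suc j) f) n)
    ≡⟨ cong (shift (suc j) f n +_) (shift-∑ (suc j) n (λ t → shift (suc t * suc j) f) n) ⟨
  shift (suc j) f n + shift (suc j) (X≤ n (suc j) f) n
    ≡⟨ cong (shift (suc j) f n +_) (shift-cong (suc j) n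
         (λ i e → X≤-stable n j f i (≤-trans (m≤n+m i (suc j)) (≤-reflexive e)))) ⟩
  shift (suc j) f n + shift (suc j) (X (suc j) f) n
    ≡⟨ shift-+ (suc j) f (X (suc j) f) n ⟨
  shift (suc j) (λ i → f i + X (suc j) f i) n ∎
  where open ≡-Reasoning

X-cong : ∀ j {f g} → (∀ n → f n ≡ g n) → ∀ n → X j f n ≡ X j g n
X-cong j eq n = ∑-cong n (λ t _ → shift-cong (suc t * j) n (λ i _ → eq i))

X-linear : ∀ j c f g n → X j (λ i → f i + c * g i) n ≡ X j f n + c * X j g n
X-linear j c f g n = trans
  (∑-cong n (λ t _ → shift-linear (suc t * j) c f g n)) (∑-linear n c _ _)

X-even : ∀ {j n f} → 2 ∣ j → (∀ i → 2 ∤ i → f i ≡ 0) → 2 ∤ n → X j f n ≡ 0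
X-even {j} {n} 2∣j f-even 2∤n = ∑-zero n (λ t _ → shift-zero (suc t * j) n
  (λ i e → f-even i (λ 2∣i → 2∤n (subst (2 ∣_) e (∣m∣n⇒∣m+n (∣n⇒∣m*n (suc t) 2∣j) 2∣i)))))

δ-even : ∀ i → 2 ∤ i → δ i ≡ 0
δ-even zero    2∤0 = contradiction (2 ∣0) 2∤0
δ-even (suc i) _   = refl

-- The terms of the double sum are symmetric, and the diagonal ones shift by even amounts.
XXδ-even : ∀ j n → 2 ∤ n → ∃[ r ] X (suc j) (X (suc j) δ) n ≡ 2 * r
XXδ-even j′ n 2∤n with ∑-diagonal n a a-sym
  where
  j = suc j′
  a : ℕ → ℕ → ℕ
  a t u = shift (suc t * j + suc u * j) δ n
  a-sym : ∀ t u → a t u ≡ a u t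
  a-sym t u = cong (λ k → shift k δ n) (+-comm (suc t * j) (suc u * j))
... | r , eq = r , (begin
  X j (X j δ) n
    -- The inner sum is extended from its own exponent to `n`, so that the double sum runs over a
    -- square.
    ≡⟨ ∑-cong n (λ t _ → shift-cong (suc t * j) n
         (λ i e → sym (X≤-stable n j′ δ i (≤-trans (m≤n+m i (suc t * j)) (≤-reflexive e))))) ⟩
  ∑ n (λ t → shift (suc t * j) (X≤ n j δ) n)
    ≡⟨ ∑-cong n (λ t _ → shift-∑ (suc t * j) n (λ u → shift (suc u * j) δ) n) ⟩
  ∑ n (λ t → ∑ n (λ u → shift (suc t * j) (shift (suc u * j) δ) n))
    ≡⟨ ∑-cong n (λ t _ → ∑-cong n (λ u _ → shift-shift (suc t * j) (suc u * j) δ n)) ⟩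
  ∑ n (λ t → ∑ n (λ u → shift (suc t * j + suc u * j) δ n))
    ≡⟨ eq ⟩
  ∑ n (λ t → shift (suc t * j + suc t * j) δ n) + 2 * r
    ≡⟨ cong (_+ 2 * r) (∑-zero n (λ t _ → shift-zero (suc t * j + suc t * j) n
         (λ i e → δ-even i (λ 2∣i → 2∤n (subst (2 ∣_) e (∣m∣n⇒∣m+n (double (suc t * j)) 2∣i)))))) ⟩
  2 * r ∎)
  where
  open ≡-Reasoning
  j = suc j′
  double : ∀ k → 2 ∣ k + k
  double k = divides k (trans (cong (k +_) (sym (+-identityʳ k))) (*-comm 2 k))

shift-δ : ∀ k n → k ≢ n → shift k δ n ≡ 0
shift-δ k n k≢n = shift-zero k n λ
  { zero e → contradiction (trans (sym (+-identityʳ k)) e) k≢n ; (suc i) e → refl }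

-- For n ≥ 1 the sum is the number of divisors of n.
divisors-even : ∀ n → (∀ x → x * x ≢ n) → ∃[ r ] ∑ n (λ j → X (suc j) δ n) ≡ 2 * r
-- The term at `(j , t)` is 1 if (t+1)(j+1) = n and 0 otherwise. Exchanging the factors is the
-- symmetry, and a nonzero diagonal term would make `n` a square.
divisors-even n nonsquare with ∑-diagonal n (λ j t → shift (suc t * suc j) δ n)
                                 (λ j t → cong (λ k → shift k δ n) (*-comm (suc t) (suc j)))
... | r , eq = r , trans eq (cong (_+ 2 * r)
  (∑-zero n (λ i _ → shift-δ (suc i * suc i) n (nonsquare (suc i)))))

-- Powers of (1 + q^j) / (1 - q^j) modulo powers of 2

-- Multiplication by (1 + q^j) / (1 - q^j), provided j ≥ 1.
T : ℕ → Series → Series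
T j f n = f n + 2 * X j f n

T-cong : ∀ j {f g} → (∀ n → f n ≡ g n) → ∀ n → T j f n ≡ T j g n
T-cong j eq n = cong₂ (λ x y → x + 2 * y) (eq n) (X-cong j eq n)

T-linear : ∀ j c f g n → T j (λ i → f i + c * g i) n ≡ T j f n + c * T j g n
T-linear j c f g n = trans (cong (λ x → f n + c * g n + 2 * x) (X-linear j c f g n))
  (ring c (f n) (g n) (X j f n) (X j g n))
  where
  ring : ∀ c a b x y → a + c * b + 2 * (x + c * y) ≡ a + 2 * x + c * (b + 2 * y)
  ring = solve-∀

T^ : ℕ → ℕ → Series → Series
T^ j zero    f = f
T^ j (suc s) f = T j (T^ j s f)

T^-cong : ∀ j s {f g} → (∀ n → f n ≡ g n) → ∀ n → T^ j s f n ≡ T^ j s g n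
T^-cong j zero    eq = eq
T^-cong j (suc s) eq = T-cong j (T^-cong j s eq)

T^-linear : ∀ j s c f g n → T^ j s (λ i → f i + c * g i) n ≡ T^ j s f n + c * T^ j s g n
T^-linear j zero    c f g n = refl
T^-linear j (suc s) c f g n =
  trans (T-cong j (T^-linear j s c f g) n) (T-linear j c (T^ j s f) (T^ j s g) n)

T^-+ : ∀ j a b f → T^ j (a + b) f ≡ T^ j a (T^ j b f)
T^-+ j zero    b f = refl
T^-+ j (suc a) b f = cong (T j) (T^-+ j a b f)

T^-mod-2 : ∀ j s f → Σ[ h ∈ Series ] ∀ n → T^ j s f n ≡ f n + 2 * h n
T^-mod-2 j zero    f = (λ _ → 0) , λ n → sym (+-identityʳ (f n))
T^-mod-2 j (suc s) f with T^-mod-2 j s f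
... | h , eq = (λ n → h n + X j (T^ j s f) n) , λ n →
  trans (cong (_+ 2 * X j (T^ j s f) n) (eq n)) (ring (f n) (h n) (X j (T^ j s f) n))
  where
  ring : ∀ a b x → a + 2 * b + 2 * x ≡ a + 2 * (b + x)
  ring = solve-∀

-- Modulo 4 the square of `T j` is the identity, so an odd power acts as `T j` itself.
T^-odd-mod-4 : ∀ j b f → Σ[ h ∈ Series ] ∀ n → T^ j (2 * b + 1) f n ≡ f n + 2 * X j f n + 4 * h n
T^-odd-mod-4 j zero    f = (λ _ → 0) , λ n → sym (+-identityʳ _)
T^-odd-mod-4 j (suc b) f with T^-odd-mod-4 j b f
... | h , eq = h′ , λ n → begin
  T^ j (2 * suc b + 1) f n
    ≡⟨ cong (λ s → T^ j s f n) (exponent b) ⟩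
  g n + 2 * X j g n + 2 * X j (λ i → g i + 2 * X j g i) n
    ≡⟨ cong (λ x → g n + 2 * X j g n + 2 * x) (X-linear j 2 g (X j g) n) ⟩
  g n + 2 * X j g n + 2 * (X j g n + 2 * X j (X j g) n)
    ≡⟨ cong (λ x → x + 2 * X j g n + 2 * (X j g n + 2 * X j (X j g) n)) (eq n) ⟩
  f n + 2 * X j f n + 4 * h n + 2 * X j g n + 2 * (X j g n + 2 * X j (X j g) n)
    ≡⟨ ring (f n) (X j f n) (h n) (X j g n) (X j (X j g) n) ⟩
  f n + 2 * X j f n + 4 * h′ n ∎
  where
  open ≡-Reasoning
  g h′ : Series
  g = T^ j (2 * b + 1) f
  h′ n = h n + X j g n + X j (X j g) n
  exponent : ∀ b → 2 * suc b + 1 ≡ 2 + (2 * b + 1)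
  exponent = solve-∀
  ring : ∀ a x h y z → a + 2 * x + 4 * h + 2 * y + 2 * (y + 2 * z) ≡ a + 2 * x + 4 * (h + y + z)
  ring = solve-∀

-- T j (T j f) = f + 4 Y j f.
Y : ℕ → Series → Series
Y j f n = X j f n + X j (X j f) n

Y-linear : ∀ j c f g n → Y j (λ i → f i + c * g i) n ≡ Y j f n + c * Y j g n
Y-linear j c f g n = trans
  (cong₂ _+_ (X-linear j c f g n)
    (trans (X-cong j (X-linear j c f g) n) (X-linear j c (X j f) (X j g) n)))
  (ring c (X j f n) (X j g n) (X j (X j f) n) (X j (X j g) n))
  where
  ring : ∀ c a b x y → a + c * b + (x + c * y) ≡ a + x + c * (b + y)
  ring = solve-∀

-- Induction by squaring, starting from `T j` squared = 1 + 4 `Y j`. With Q = 2^(m+2), squaring 1 +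
-- Q g gives 1 + 2 Q g up to a multiple of Q², which 4 Q divides.
T^-2^ : ∀ j m f → Σ[ h ∈ Series ] ∀ n →
  T^ j (2 ^ suc m) f n ≡ f n + 2 ^ (2 + m) * (Y j f n + 2 * h n)
T^-2^ j zero f = (λ _ → 0) , λ n → trans
  (cong (λ x → f n + 2 * X j f n + 2 * x) (X-linear j 2 f (X j f) n))
  (ring (f n) (X j f n) (X j (X j f) n))
  where
  ring : ∀ a x y → a + 2 * x + 2 * (x + 2 * y) ≡ a + 4 * (x + y + 0)
  ring = solve-∀
T^-2^ j (suc m) f with T^-2^ j m f
-- The error `h` is known only for the given series, so the induction hypothesis is applied a second
-- time, to the correction term.
... | h , eq with T^-2^ j m (λ n → Y j f n + 2 * h n)
-- Since Q = 4 P, the term Q² k equals 2 Q times 2 P k.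
... | h′ , eq′ = (λ n → h n + P * k n) , λ n → begin
  T^ j (2 ^ suc (suc m)) f n
    ≡⟨ cong (λ s → T^ j (M + s) f n) (+-identityʳ M) ⟩
  T^ j (M + M) f n
    ≡⟨ cong (λ φ → φ n) (T^-+ j M M f) ⟩
  T^ j M (T^ j M f) n
    ≡⟨ T^-cong j M eq n ⟩
  T^ j M (λ i → f i + Q * g i) n
    ≡⟨ T^-linear j M Q f g n ⟩
  T^ j M f n + Q * T^ j M g n
    ≡⟨ cong₂ (λ x y → x + Q * y) (eq n) (eq′ n) ⟩
  f n + Q * g n + Q * (g n + Q * k n)
    ≡⟨ ring P (f n) (Y j f n) (h n) (k n) ⟩
  f n + 2 ^ (3 + m) * (Y j f n + 2 * (h n + P * k n)) ∎
  where
  open ≡-Reasoning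
  M P Q : ℕ
  M = 2 ^ suc m
  P = 2 ^ m
  Q = 2 ^ (2 + m)
  g k : Series
  g n = Y j f n + 2 * h n
  k n = Y j g n + 2 * h′ n
  ring : ∀ P a y h k → a + 2 * (2 * P) * (y + 2 * h) + 2 * (2 * P) * (y + 2 * h + 2 * (2 * P) * k)
                       ≡ a + 2 * (2 * (2 * P)) * (y + 2 * (h + P * k))
  ring = solve-∀

-- Multiplying `α` factors 1 + Q (`Y` + 2 h) adds up their linear terms. Cross terms carry Q², a
-- multiple of 2 Q.
T^-2^* : ∀ j m α f → Σ[ h ∈ Series ] ∀ n →
  T^ j (2 ^ suc m * α) f n ≡ f n + 2 ^ (2 + m) * (α * Y j f n + 2 * h n)
T^-2^* j m zero f = (λ _ → 0) , λ n → begin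
  T^ j (2 ^ suc m * 0) f n   ≡⟨ cong (λ s → T^ j s f n) (*-zeroʳ (2 ^ suc m)) ⟩
  f n                        ≡⟨ +-identityʳ (f n) ⟨
  f n + 0                    ≡⟨ cong (f n +_) (*-zeroʳ (2 ^ (2 + m))) ⟨
  f n + 2 ^ (2 + m) * 0      ∎
  where open ≡-Reasoning
T^-2^* j m (suc α) f with T^-2^* j m α f | T^-2^ j m f
... | h , eq | h₁ , eq₁ with T^-2^ j m (λ n → α * Y j f n + 2 * h n)
... | h₂ , eq₂ = (λ n → h n + h₁ n + 2 * P * k n) , λ n → begin
  T^ j (M * suc α) f n
    ≡⟨ cong (λ s → T^ j s f n) (*-suc M α) ⟩
  T^ j (M + M * α) f n
    ≡⟨ cong (λ φ → φ n) (T^-+ j M (M * α) f) ⟩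
  T^ j M (T^ j (M * α) f) n
    ≡⟨ T^-cong j M eq n ⟩
  T^ j M (λ i → f i + Q * g i) n
    ≡⟨ T^-linear j M Q f g n ⟩
  T^ j M f n + Q * T^ j M g n
    ≡⟨ cong₂ (λ x y → x + Q * y) (eq₁ n) (eq₂ n) ⟩
  f n + Q * (Y j f n + 2 * h₁ n) + Q * (g n + Q * k n)
    ≡⟨ ring P α (f n) (Y j f n) (h n) (h₁ n) (k n) ⟩
  f n + Q * (suc α * Y j f n + 2 * (h n + h₁ n + 2 * P * k n)) ∎
  where
  open ≡-Reasoning
  M P Q : ℕ
  M = 2 ^ suc m
  P = 2 ^ m
  Q = 2 ^ (2 + m)
  g k : Series
  g n = α * Y j f n + 2 * h n
  k n = Y j g n + 2 * h₂ n
  ring : ∀ P α a y h h₁ k →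
    a + 2 * (2 * P) * (y + 2 * h₁) + 2 * (2 * P) * (α * y + 2 * h + 2 * (2 * P) * k)
    ≡ a + 2 * (2 * P) * ((1 + α) * y + 2 * (h + h₁ + 2 * P * k))
  ring = solve-∀

-- The product over all part sizes modulo powers of 2

-- The generating function of the overpartitions with all parts at most j.
B : ℕ → ℕ → Series
B s zero    = δ
B s (suc j) = T^ (suc j) (colours s (suc j)) (B s j)

colours-∣ : ∀ s j → 2 ∣ j → colours s j ≡ 1
colours-∣ s j 2∣j = cong (if_then 1 else s) (dec-true (2 ∣? j) 2∣j)

colours-∤ : ∀ s j → 2 ∤ j → colours s j ≡ s
colours-∤ s j 2∤j = cong (if_then 1 else s) (dec-false (2 ∣? j) 2∤j)

-- Even sizes have one colour, so for odd `s` every size has an odd number of colours and all sizes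
-- can be treated alike.
colours-odd : ∀ β j → ∃[ b ] colours (2 * β + 1) j ≡ 2 * b + 1
colours-odd β j with 2 ∣? j
... | yes 2∣j = 0 , colours-∣ (2 * β + 1) j 2∣j
... | no  2∤j = β , colours-∤ (2 * β + 1) j 2∤j

B-odd-mod-4 : ∀ β j → Σ[ v ∈ Series ] ∀ n →
  B (2 * β + 1) j n ≡ δ n + 2 * (∑ j (λ i → X (suc i) δ n) + 2 * v n)
B-odd-mod-4 β zero    = (λ _ → 0) , λ n → sym (+-identityʳ (δ n))
B-odd-mod-4 β (suc j) with B-odd-mod-4 β j | colours-odd β (suc j)
... | v , eq | b , c with T^-odd-mod-4 (suc j) b (B (2 * β + 1) j)
... | h , eq′ = (λ n → v n + X (suc j) w n + h n) , λ n → begin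
  T^ (suc j) (colours (2 * β + 1) (suc j)) f n
    ≡⟨ cong (λ s → T^ (suc j) s f n) c ⟩
  T^ (suc j) (2 * b + 1) f n
    ≡⟨ eq′ n ⟩
  f n + 2 * X (suc j) f n + 4 * h n
    ≡⟨ cong₂ (λ x y → x + 2 * y + 4 * h n) (eq n)
         (trans (X-cong (suc j) eq n) (X-linear (suc j) 2 δ w n)) ⟩
  δ n + 2 * w n + 2 * (X (suc j) δ n + 2 * X (suc j) w n) + 4 * h n
    ≡⟨ ring (δ n) (∑ j (λ i → X (suc i) δ n)) (v n) (X (suc j) δ n) (X (suc j) w n) (h n) ⟩
  δ n + 2 * (∑ j (λ i → X (suc i) δ n) + X (suc j) δ n + 2 * (v n + X (suc j) w n + h n)) ∎
  where
  open ≡-Reasoning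
  f w : Series
  f = B (2 * β + 1) j
  w n = ∑ j (λ i → X (suc i) δ n) + 2 * v n
  ring : ∀ a d v x y h → a + 2 * (d + 2 * v) + 2 * (x + 2 * y) + 4 * h
                         ≡ a + 2 * (d + x + 2 * (v + y + h))
  ring = solve-∀

-- One induction on `j` carries all four properties. That `e` is congruent to `δ` modulo 2 lets
-- `Y e` be replaced by `Y δ` in `u`. The last property is restricted to odd exponents, where the
-- square of `X` is even.
B-2^*-mod : ∀ m α j → Σ[ e ∈ Series ] Σ[ u ∈ Series ]
  (∀ n → B (2 ^ suc m * α) j n ≡ e n + 2 ^ (2 + m) * u n)
  × (∀ n → 2 ∤ n → e n ≡ 0)
  × (Σ[ e′ ∈ Series ] ∀ n → e n ≡ δ n + 2 * e′ n)
  × (∀ n → 2 ∤ n → ∃[ r ] u n ≡ α * ∑ j (λ i → X (suc i) δ n) + 2 * r)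
B-2^*-mod m α zero = δ , (λ _ → 0)
  , (λ n → sym (trans (cong (δ n +_) (*-zeroʳ (2 ^ (2 + m)))) (+-identityʳ _)))
  , δ-even
  , ((λ _ → 0) , λ n → sym (+-identityʳ (δ n)))
  , λ n _ → 0 , sym (trans (+-identityʳ _) (*-zeroʳ α))
B-2^*-mod m α (suc j) with B-2^*-mod m α j | 2 ∣? suc j
-- An even size has one colour: `T` acts on both `e` and `u`, keeps `e` even and changes `u` by a
-- multiple of 2.
... | e , u , eq , e-even , (e′ , e≡) , u≡ | yes 2∣j = T (suc j) e , T (suc j) u
  , (λ n → begin
      T^ (suc j) (colours S (suc j)) (B S j) n
        ≡⟨ cong (λ s → T^ (suc j) s (B S j) n) (colours-∣ S (suc j) 2∣j) ⟩
      T (suc j) (B S j) n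
        ≡⟨ T-cong (suc j) eq n ⟩
      T (suc j) (λ i → e i + 2 ^ (2 + m) * u i) n
        ≡⟨ T-linear (suc j) (2 ^ (2 + m)) e u n ⟩
      T (suc j) e n + 2 ^ (2 + m) * T (suc j) u n ∎)
  , (λ n 2∤n → cong₂ (λ x y → x + 2 * y) (e-even n 2∤n) (X-even 2∣j e-even 2∤n))
  , ((λ n → e′ n + X (suc j) e n) , λ n →
       trans (cong (_+ 2 * X (suc j) e n) (e≡ n)) (ring₁ (δ n) (e′ n) (X (suc j) e n)))
  , λ n 2∤n → let r , u≡ₙ = u≡ n 2∤n in r + X (suc j) u n , (begin
    u n + 2 * X (suc j) u n
      ≡⟨ cong (_+ 2 * X (suc j) u n) u≡ₙ ⟩
    α * D n + 2 * r + 2 * X (suc j) u n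
      ≡⟨ ring₂ α (D n) r (X (suc j) u n) ⟩
    α * (D n + 0) + 2 * (r + X (suc j) u n)
      -- The new divisor term is zero, since an even number does not divide an odd `n`.
      ≡⟨ cong (λ x → α * (D n + x) + 2 * (r + X (suc j) u n)) (X-even 2∣j δ-even 2∤n) ⟨
    α * (D n + X (suc j) δ n) + 2 * (r + X (suc j) u n) ∎)
  where
  open ≡-Reasoning
  S : ℕ
  S = 2 ^ suc m * α
  D : Series
  D n = ∑ j (λ i → X (suc i) δ n)
  ring₁ : ∀ a b x → a + 2 * b + 2 * x ≡ a + 2 * (b + x)
  ring₁ = solve-∀
  ring₂ : ∀ α d r x → α * d + 2 * r + 2 * x ≡ α * (d + 0) + 2 * (r + x)
  ring₂ = solve-∀
-- An odd size has `S` colours: `e` stays as it is, and the new factor contributes only to `u`.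
... | e , u , eq , e-even , (e′ , e≡) , u≡ | no 2∤j
    with T^-2^* (suc j) m α e | T^-mod-2 (suc j) (2 ^ suc m * α) u
... | h , eqₑ | k , eqᵤ = e , u′
  , (λ n → begin
      T^ (suc j) (colours S (suc j)) (B S j) n
        ≡⟨ cong (λ s → T^ (suc j) s (B S j) n) (colours-∤ S (suc j) 2∤j) ⟩
      T^ (suc j) S (B S j) n
        ≡⟨ T^-cong (suc j) S eq n ⟩
      T^ (suc j) S (λ i → e i + Q * u i) n
        ≡⟨ T^-linear (suc j) S Q e u n ⟩
      T^ (suc j) S e n + Q * T^ (suc j) S u n
        ≡⟨ cong₂ (λ x y → x + Q * y) (eqₑ n) (eqᵤ n) ⟩
      e n + Q * (α * Y (suc j) e n + 2 * h n) + Q * (u n + 2 * k n)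
        ≡⟨ ring₁ Q (e n) (α * Y (suc j) e n) (h n) (u n) (k n) ⟩
      e n + Q * u′ n ∎)
  , e-even
  , (e′ , e≡)
  , λ n 2∤n → let r , u≡ₙ = u≡ n 2∤n ; r′ , XX≡ = XXδ-even j n 2∤n in
    r + α * (r′ + Y (suc j) e′ n) + h n + k n , (begin
    u n + α * Y (suc j) e n + 2 * (h n + k n)
      ≡⟨ cong₂ (λ x y → x + α * y + 2 * (h n + k n)) u≡ₙ (Ye≡ n) ⟩
    α * D n + 2 * r + α * (X (suc j) δ n + X (suc j) (X (suc j) δ) n + 2 * Y (suc j) e′ n)
      + 2 * (h n + k n)
      -- At odd `n` the square of `X` is even, so of `Y δ` only `X δ` survives modulo 2.
      ≡⟨ cong (λ x → α * D n + 2 * r + α * (X (suc j) δ n + x + 2 * Y (suc j) e′ n)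
                     + 2 * (h n + k n)) XX≡ ⟩
    α * D n + 2 * r + α * (X (suc j) δ n + 2 * r′ + 2 * Y (suc j) e′ n) + 2 * (h n + k n)
      ≡⟨ ring₂ α (D n) r (X (suc j) δ n) r′ (Y (suc j) e′ n) (h n) (k n) ⟩
    α * (D n + X (suc j) δ n) + 2 * (r + α * (r′ + Y (suc j) e′ n) + h n + k n) ∎)
  where
  open ≡-Reasoning
  S Q : ℕ
  S = 2 ^ suc m * α
  Q = 2 ^ (2 + m)
  D u′ : Series
  D n = ∑ j (λ i → X (suc i) δ n)
  u′ n = u n + α * Y (suc j) e n + 2 * (h n + k n)
  Ye≡ : ∀ n → Y (suc j) e n ≡ Y (suc j) δ n + 2 * Y (suc j) e′ n
  Ye≡ n = trans
    (cong₂ _+_ (X-cong (suc j) e≡ n) (X-cong (suc j) (X-cong (suc j) e≡) n))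
    (Y-linear (suc j) 2 δ e′ n)
  ring₁ : ∀ Q e y h u k → e + Q * (y + 2 * h) + Q * (u + 2 * k) ≡ e + Q * (u + y + 2 * (h + k))
  ring₁ = solve-∀
  ring₂ : ∀ α d r x r′ y h k →
    α * d + 2 * r + α * (x + 2 * r′ + 2 * y) + 2 * (h + k)
    ≡ α * (d + x) + 2 * (r + α * (r′ + y) + h + k)
  ring₂ = solve-∀

-- Counting overpartitions

count : ∀ {A : Set} {P : Pred A 0ℓ} → Decidable P → List A → ℕ
count P? xs = length (filter P? xs)

count-++ : ∀ {A : Set} {P : Pred A 0ℓ} (P? : Decidable P) xs ys →
  count P? (xs ++ ys) ≡ count P? xs + count P? ys
count-++ P? xs ys = trans (cong length (filter-++ P? xs ys)) (length-++ (filter P? xs))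

count-map : ∀ {A B : Set} {P : Pred B 0ℓ} (P? : Decidable P) (f : A → B) xs →
  count P? (map f xs) ≡ count (P? ∘ f) xs
count-map P? f []       = refl
count-map P? f (x ∷ xs) with does (P? (f x))
... | true  = cong suc (count-map P? f xs)
... | false = count-map P? f xs

count-prod : ∀ {A B C : Set} {P : Pred C 0ℓ} (P? : Decidable P) (f : A → B → C) xs ys →
  count P? (cartesianProductWith f xs ys) ≡ sum (map (λ x → count (P? ∘ f x) ys) xs)
count-prod P? f []       ys = refl
count-prod P? f (x ∷ xs) ys = trans (count-++ P? (map (f x) ys) _)
  (cong₂ _+_ (count-map P? (f x) ys) (count-prod P? f xs ys))

count-none : ∀ {A : Set} {P : Pred A 0ℓ} (P? : Decidable P) xs → (∀ x → ¬ P x) → count P? xs ≡ 0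
count-none P? xs ¬P = cong length (filter-none P? (universal ¬P xs))

-- Raising every weight by `k` multiplies the counting series by q^k. Here `k` will be the size of
-- the first part.
count-shift : ∀ {A : Set} {Q : Pred A 0ℓ} (Q? : Decidable Q) (w : A → ℕ) k xs n →
  count (λ x → Q? x ×-dec (k + w x ≟ n)) xs
  ≡ shift k (λ i → count (λ x → Q? x ×-dec (w x ≟ i)) xs) n
count-shift Q? w zero    xs n       = refl
count-shift Q? w (suc k) xs zero    = count-none _ xs λ _ ()
count-shift Q? w (suc k) xs (suc n) = trans
  (cong length (filter-≐ (λ x → Q? x ×-dec (suc k + w x ≟ suc n)) (λ x → Q? x ×-dec (k + w x ≟ n))
    ((λ (q , e) → q , suc-injective e) , λ (q , e) → q , cong suc e) xs))
  (count-shift Q? w k xs n)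

sum-concatMap : ∀ {A B : Set} (h : B → ℕ) (f : A → List B) xs →
  sum (map h (concatMap f xs)) ≡ sum (map (λ x → sum (map h (f x))) xs)
sum-concatMap h f []       = refl
sum-concatMap h f (x ∷ xs) = begin
  sum (map h (f x ++ concatMap f xs))
    ≡⟨ cong sum (map-++ h (f x) _) ⟩
  sum (map h (f x) ++ map h (concatMap f xs))
    ≡⟨ sum-++ (map h (f x)) _ ⟩
  sum (map h (f x)) + sum (map h (concatMap f xs))
    ≡⟨ cong (sum (map h (f x)) +_) (sum-concatMap h f xs) ⟩
  sum (map h (f x)) + sum (map (λ x → sum (map h (f x))) xs) ∎
  where open ≡-Reasoning

sum-upTo : ∀ n f → sum (map f (upTo n)) ≡ ∑ n f
sum-upTo zero    f = refl
sum-upTo (suc n) f = begin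
  sum (map f (upTo (suc n)))             ≡⟨ cong (sum ∘ map f) (upTo-∷ʳ n) ⟨
  sum (map f (upTo n ++ n ∷ []))         ≡⟨ cong sum (map-++ f (upTo n) (n ∷ [])) ⟩
  sum (map f (upTo n) ++ f n ∷ [])       ≡⟨ sum-++ (map f (upTo n)) (f n ∷ []) ⟩
  sum (map f (upTo n)) + (f n + 0)       ≡⟨ cong₂ _+_ (sum-upTo n f) (+-identityʳ (f n)) ⟩
  ∑ n f + f n                            ∎
  where open ≡-Reasoning

sum-parts : ∀ s n (h : Part → ℕ) → sum (map h (parts s n)) ≡
  ∑ n (λ i → ∑ (colours s (suc i)) (λ c → h (part (suc i) c false) + h (part (suc i) c true)))
sum-parts s n h = begin
  sum (map h (concatMap ofSize (map suc (upTo n))))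
    ≡⟨ sum-concatMap h ofSize (map suc (upTo n)) ⟩
  sum (map (λ j → sum (map h (ofSize j))) (map suc (upTo n)))
    ≡⟨ cong sum (map-∘ (upTo n)) ⟨
  sum (map (λ i → sum (map h (ofSize (suc i)))) (upTo n))
    ≡⟨ sum-upTo n _ ⟩
  ∑ n (λ i → sum (map h (ofSize (suc i))))
    ≡⟨ ∑-cong n (λ i _ → begin
         sum (map h (ofSize (suc i)))
           ≡⟨ sum-concatMap h (ofKind (suc i)) (upTo (colours s (suc i))) ⟩
         sum (map (λ c → sum (map h (ofKind (suc i) c))) (upTo (colours s (suc i))))
           ≡⟨ sum-upTo (colours s (suc i)) _ ⟩
         ∑ (colours s (suc i)) (λ c → sum (map h (ofKind (suc i) c)))
           ≡⟨ ∑-cong (colours s (suc i)) (λ c _ →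
                cong (h (part (suc i) c false) +_) (+-identityʳ _)) ⟩
         ∑ (colours s (suc i)) (λ c → h (part (suc i) c false) + h (part (suc i) c true)) ∎) ⟩
  ∑ n (λ i → ∑ (colours s (suc i)) (λ c → h (part (suc i) c false) + h (part (suc i) c true))) ∎
  where
  open ≡-Reasoning
  ofKind : ℕ → ℕ → List Part
  ofKind j c = part j c false ∷ part j c true ∷ []
  ofSize : ℕ → List Part
  ofSize j = concatMap (ofKind j) (upTo (colours s j))

-- Recursion on the first part

χ▷ : Part → Part → ℕ
χ▷ x y = if does (x ▷? y) then 1 else 0

χ▷-yes : ∀ x y → x ▷ y → χ▷ x y ≡ 1
χ▷-yes x y x▷y = cong (if_then 1 else 0) (dec-true (x ▷? y) x▷y)

χ▷-no : ∀ x y → ¬ x ▷ y → χ▷ x y ≡ 0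
χ▷-no x y ¬x▷y = cong (if_then 1 else 0) (dec-false (x ▷? y) ¬x▷y)

-- Overpartitions of n with first part y, followed by at most l parts from as.
K : List Part → ℕ → Part → Series
K as l y n = count (λ w → isOverpartition? n (y ∷ w)) (words l as)

-- Linkedness of `y ∷ z ∷ w` splits into `y ▷ z`, which does not involve `w`, and linkedness of
-- `z ∷ w`.
Linked-∷∷ : ∀ y z as l n →
  count (λ w → linked? _▷?_ (y ∷ z ∷ w) ×-dec (size z + sum (map size w) ≟ n)) (words l as)
  ≡ χ▷ y z * K as l z n
Linked-∷∷ y z as l n = split (y ▷? z)
  where
  split : Dec (y ▷ z) →
    count (λ w → linked? _▷?_ (y ∷ z ∷ w) ×-dec (size z + sum (map size w) ≟ n)) (words l as)
    ≡ χ▷ y z * K as l z n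
  split (yes y▷z) = trans
    (cong length (filter-≐ _ (λ w → isOverpartition? n (z ∷ w))
      ((λ (L , e) → Linked.tail L , e) , λ (L , e) → y▷z ∷ L , e) (words l as)))
    (sym (trans (cong (_* K as l z n) (χ▷-yes y z y▷z)) (+-identityʳ _)))
  split (no ¬y▷z) = trans
    (count-none _ (words l as) λ w (L , _) → ¬y▷z (Linked.head L))
    (sym (cong (_* K as l z n) (χ▷-no y z ¬y▷z)))

K-zero : ∀ as y n → K as 0 y n ≡ shift (size y) δ n
K-zero as y n = trans
  (count-shift (λ w → linked? _▷?_ (y ∷ w)) (sum ∘ map size) (size y) ([] ∷ []) n)
  (shift-cong (size y) n λ { zero _ → refl ; (suc i) _ → refl })

-- After `y` the list either ends, which gives `δ`, or goes on with some `z` such that `y ▷ z`.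
K-suc : ∀ as l y n → K as (suc l) y n ≡
  shift (size y) (λ i → δ i + sum (map (λ z → χ▷ y z * K as l z i) as)) n
K-suc as l y n = trans
  (count-shift (λ w → linked? _▷?_ (y ∷ w)) (sum ∘ map size) (size y) (words (suc l) as) n)
  (shift-cong (size y) n λ i _ → begin
    count (P? i) ([] ∷ cartesianProductWith _∷_ as (words l as))
      ≡⟨ count-++ (P? i) ([] ∷ []) _ ⟩
    count (P? i) ([] ∷ []) + count (P? i) (cartesianProductWith _∷_ as (words l as))
      ≡⟨ cong₂ _+_ (count-[] i) (count-prod (P? i) _∷_ as (words l as)) ⟩
    δ i + sum (map (λ z → count (P? i ∘ (z ∷_)) (words l as)) as)
      ≡⟨ cong (λ ns → δ i + sum ns) (map-cong (λ z → Linked-∷∷ y z as l i) as) ⟩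
    δ i + sum (map (λ z → χ▷ y z * K as l z i) as) ∎)
  where
  open ≡-Reasoning
  P? : ∀ i w → Dec (Linked _▷_ (y ∷ w) × sum (map size w) ≡ i)
  P? i w = linked? _▷?_ (y ∷ w) ×-dec (sum (map size w) ≟ i)
  count-[] : ∀ i → count (P? i) ([] ∷ []) ≡ δ i
  count-[] zero    = refl
  count-[] (suc i) = refl

-- Comparison with the generating function

T^-0 : ∀ j c f → T^ j c f 0 ≡ f 0
T^-0 j zero    f = refl
T^-0 j (suc c) f = trans (+-identityʳ _) (T^-0 j c f)

B-0 : ∀ s j → B s j 0 ≡ 1
B-0 s zero    = refl
B-0 s (suc j) = trans (T^-0 (suc j) (colours s (suc j)) (B s j)) (B-0 s j)

T^-telescope : ∀ j c f n → T^ j c f n ≡ f n + ∑ c (λ d → 2 * X j (T^ j d f) n)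
T^-telescope j zero    f n = sym (+-identityʳ (f n))
T^-telescope j (suc c) f n =
  trans (cong (_+ 2 * X j (T^ j c f) n) (T^-telescope j c f n)) (+-assoc (f n) _ _)

-- Overpartitions sorted by the size and colour of their first part. The factor 2 is the choice of
-- overlining it, and `δ` is the empty one.
B-telescope : ∀ s j n → B s j n ≡
  δ n + ∑ j (λ i → ∑ (colours s (suc i)) (λ d → 2 * X (suc i) (T^ (suc i) d (B s i)) n))
B-telescope s zero    n = sym (+-identityʳ (δ n))
B-telescope s (suc j) n = trans (T^-telescope (suc j) (colours s (suc j)) (B s j) n)
  (trans (cong (_+ ∑ (colours s (suc j)) (λ d → 2 * X (suc j) (T^ (suc j) d (B s j)) n)) (B-telescope s j n))
    (+-assoc (δ n) _ _))

module _ (s N : ℕ) where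

  private as = parts s N

  -- The parts that may follow one of size suc j and colour c are those of smaller size, those
  -- of the same size and smaller colour, and the same part again, not overlined.
  sum-successors : ∀ (H : ℕ → ℕ → ℕ) (h : Part → ℕ) {j c} b → j < N → c < colours s (suc j) →
    (∀ i d b′ → i < N → d < colours s (suc i) → h (part (suc i) d b′) ≡ H i d) →
    sum (map (λ z → χ▷ (part (suc j) c b) z * h z) as)
    ≡ ∑ j (λ i → ∑ (colours s (suc i)) (λ d → 2 * H i d)) + (∑ c (λ d → 2 * H j d) + H j c)
  sum-successors H h {j} {c} b j<N c<C h≡H = begin
    sum (map (λ z → χ▷ y z * h z) as)
      ≡⟨ sum-parts s N _ ⟩
    ∑ N (λ i → ∑ (C i) (λ d → χ▷ y (z i d false) * h (z i d false)
                            + χ▷ y (z i d true) * h (z i d true)))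
      ≡⟨ ∑-cong N (λ i i<N → ∑-cong (C i) (λ d d<C →
           cong₂ (λ u v → χ▷ y (z i d false) * u + χ▷ y (z i d true) * v)
             (h≡H i d false i<N d<C) (h≡H i d true i<N d<C))) ⟩
    ∑ N (λ i → ∑ (C i) (t i))
      ≡⟨ ∑-truncate N j<N (λ i j<i → ∑-zero (C i) (λ d _ → larger i d j<i)) ⟩
    ∑ j (λ i → ∑ (C i) (t i)) + ∑ (C j) (t j)
      ≡⟨ cong₂ _+_
           (∑-cong j (λ i i<j → ∑-cong (C i) (λ d _ →
             both {i} {d} (λ _ → inj₁ (s≤s i<j)))))
           (∑-truncate (C j) c<C (λ d c<d → larger-colour d c<d)) ⟩
    ∑ j (λ i → ∑ (C i) (λ d → 2 * H i d)) + (∑ c (t j) + t j c)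
      ≡⟨ cong (∑ j (λ i → ∑ (C i) (λ d → 2 * H i d)) +_) (cong₂ _+_
           (∑-cong c (λ d d<c → both {j} {d} (λ _ → inj₂ (inj₁ (refl , d<c)))))
           same) ⟩
    ∑ j (λ i → ∑ (C i) (λ d → 2 * H i d)) + (∑ c (λ d → 2 * H j d) + H j c) ∎
    where
    open ≡-Reasoning
    C = λ i → colours s (suc i)
    y = part (suc j) c b
    z = λ i d b′ → part (suc i) d b′
    t : ℕ → ℕ → ℕ
    t i d = χ▷ y (z i d false) * H i d + χ▷ y (z i d true) * H i d
    both : ∀ {i d} → (∀ b′ → y ▷ z i d b′) → t i d ≡ 2 * H i d
    both {i} {d} y▷ = trans
      (cong₂ (λ u v → u * H i d + v * H i d)
        (χ▷-yes y (z i d false) (y▷ false)) (χ▷-yes y (z i d true) (y▷ true)))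
      (cong (_+ 1 * H i d) (+-identityʳ (H i d)))
    neither : ∀ {i d} → (∀ b′ → ¬ y ▷ z i d b′) → t i d ≡ 0
    neither {i} {d} ¬y▷ = cong₂ (λ u v → u * H i d + v * H i d)
      (χ▷-no y (z i d false) (¬y▷ false)) (χ▷-no y (z i d true) (¬y▷ true))
    larger : ∀ i d → j < i → t i d ≡ 0
    larger i d j<i = neither λ where
      _ (inj₁ (s≤s i<j))          → <-asym i<j j<i
      _ (inj₂ (inj₁ (refl , _)))  → <-irrefl refl j<i
      _ (inj₂ (inj₂ (refl , _)))  → <-irrefl refl j<i
    larger-colour : ∀ d → c < d → t j d ≡ 0
    larger-colour d c<d = neither λ where
      _ (inj₁ j<j)                      → <-irrefl refl j<j
      _ (inj₂ (inj₁ (_ , d<c)))         → <-asym d<c c<d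
      _ (inj₂ (inj₂ (_ , refl , _)))    → <-irrefl refl c<d
    same : t j c ≡ H j c
    same = trans
      (cong₂ (λ u v → u * H j c + v * H j c)
        (χ▷-yes y (z j c false) (inj₂ (inj₂ (refl , refl , refl))))
        (χ▷-no y (z j c true) λ where
          (inj₁ j<j)                  → <-irrefl refl j<j
          (inj₂ (inj₁ (_ , c<c)))     → <-irrefl refl c<c
          (inj₂ (inj₂ (_ , _ , ())))))
      (trans (+-identityʳ _) (+-identityʳ _))

  -- The first kind of part is repeated at least once (`X`), then come smaller colours of the same
  -- size (`T^`) and smaller sizes (`B`). As parts are positive, `n ≤ suc l` ensures that `l`
  -- further parts suffice.
  K-X : ∀ l j c b n → j < N → c < colours s (suc j) → n ≤ suc l →
    K as l (part (suc j) c b) n ≡ X (suc j) (T^ (suc j) c (B s j)) n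
  K-X zero j c b n j<N c<C n≤1 = begin
    K as 0 (part (suc j) c b) n
      ≡⟨ K-zero as (part (suc j) c b) n ⟩
    shift (suc j) δ n
      -- Because `n ≤ 1`, only the constant coefficient is reached, and it is 1 on both sides.
      ≡⟨ shift-cong (suc j) n (λ
           { zero    _ → sym (trans (+-identityʳ _) (trans (T^-0 (suc j) c (B s j)) (B-0 s j)))
           ; (suc i) e → contradiction n≤1
               (<⇒≱ (subst (2 ≤_) e (s≤s (≤-trans (s≤s z≤n) (m≤n+m (suc i) j))))) }) ⟩
    shift (suc j) (λ i → f i + X (suc j) f i) n
      ≡⟨ X-unfold j f n ⟨
    X (suc j) f n ∎
    where
    open ≡-Reasoning
    f = T^ (suc j) c (B s j)
  K-X (suc l) j c b n j<N c<C n≤l = begin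
    K as (suc l) y n
      ≡⟨ K-suc as l y n ⟩
    shift (suc j) (λ i → δ i + sum (map (λ z → χ▷ y z * K as l z i) as)) n
      ≡⟨ shift-cong (suc j) n (λ m e → begin
           δ m + sum (map (λ z → χ▷ y z * K as l z m) as)
             ≡⟨ cong (δ m +_) (sum-successors (H m) (λ z → K as l z m) b j<N c<C
                  (λ i d b′ i<N d<C → K-X l i d b′ m i<N d<C (bound m e))) ⟩
           δ m + (∑ j (λ i → ∑ (colours s (suc i)) (λ d → 2 * H m i d))
                  + (∑ c (λ d → 2 * H m j d) + H m j c))
             ≡⟨ +-assoc (δ m) _ _ ⟨
           δ m + ∑ j (λ i → ∑ (colours s (suc i)) (λ d → 2 * H m i d))
             + (∑ c (λ d → 2 * H m j d) + H m j c)
             ≡⟨ cong (_+ (∑ c (λ d → 2 * H m j d) + H m j c)) (B-telescope s j m) ⟨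
           B s j m + (∑ c (λ d → 2 * H m j d) + H m j c)
             ≡⟨ +-assoc (B s j m) _ _ ⟨
           B s j m + ∑ c (λ d → 2 * H m j d) + H m j c
             ≡⟨ cong (_+ H m j c) (T^-telescope (suc j) c (B s j) m) ⟨
           f m + X (suc j) f m ∎) ⟩
    shift (suc j) (λ i → f i + X (suc j) f i) n
      ≡⟨ X-unfold j f n ⟨
    X (suc j) f n ∎
    where
    open ≡-Reasoning
    y = part (suc j) c b
    f = T^ (suc j) c (B s j)
    H : ℕ → ℕ → ℕ → ℕ
    H m i d = X (suc i) (T^ (suc i) d (B s i)) m
    bound : ∀ m → suc j + m ≡ n → m ≤ suc l
    bound m e = ≤-pred (≤-trans (s≤s (m≤n+m m j)) (≤-trans (≤-reflexive e) n≤l))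

ā-suc≡B : ∀ s n → ā s (suc n) ≡ B s (suc n) (suc n)
ā-suc≡B s n = begin
  count (isOverpartition? N) ([] ∷ cartesianProductWith _∷_ as (words n as))
    -- The empty list has sum 0, not `suc n`, and is filtered out by computation.
    ≡⟨⟩
  count (isOverpartition? N) (cartesianProductWith _∷_ as (words n as))
    ≡⟨ count-prod (isOverpartition? N) _∷_ as (words n as) ⟩
  sum (map (λ y → K as n y N) as)
    ≡⟨ sum-parts s N _ ⟩
  ∑ N (λ i → ∑ (colours s (suc i)) (λ c →
    K as n (part (suc i) c false) N + K as n (part (suc i) c true) N))
    ≡⟨ ∑-cong N (λ i i<N → ∑-cong (colours s (suc i)) (λ c c<C → cong₂ _+_
         (K-X s N n i c false N i<N c<C ≤-refl)
         (trans (K-X s N n i c true N i<N c<C ≤-refl) (sym (+-identityʳ _))))) ⟩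
  ∑ N (λ i → ∑ (colours s (suc i)) (λ c → 2 * X (suc i) (T^ (suc i) c (B s i)) N))
    ≡⟨ B-telescope s N N ⟨
  B s N N ∎
  where
  open ≡-Reasoning
  N = suc n
  as = parts s N

-- Odd nonsquares

-- Descent on `k`: `p` divides `x`, and cancelling p² lowers the exponent by 2. At exponent 1,
-- cancelling `p` leaves `M` divisible by `p`.
p^odd*M-nonsquare : ∀ {p M} → Prime p → p ∤ M → ∀ k x → x * x ≢ p ^ (2 * k + 1) * M
p^odd*M-nonsquare {p} {M} p-prime p∤M k x x²≡ = descend k (subst (p ∣_) (sym x²≡) p∣rhs) x²≡
  where
  instance _ = prime⇒nonZero p-prime
  open ≡-Reasoning
  p∣rhs : p ∣ p ^ (2 * k + 1) * M
  p∣rhs = ∣m⇒∣m*n M (subst (λ e → p ∣ p ^ e) (sym (+-comm (2 * k) 1)) (m∣m*n (p ^ (2 * k))))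
  descend : ∀ k → p ∣ x * x → x * x ≢ p ^ (2 * k + 1) * M
  descend k p∣x² eq with [ id , id ]′ (euclidsLemma x x p-prime p∣x²)
  descend zero p∣x² eq | divides y refl = p∤M (divides (y * y) (*-cancelˡ-≡ M _ p (begin
    p * M            ≡⟨ cong (_* M) (*-identityʳ p) ⟨
    p ^ 1 * M        ≡⟨ eq ⟨
    y * p * (y * p)  ≡⟨ ring y p ⟩
    p * (y * y * p)  ∎)))
    where
    ring : ∀ y p → y * p * (y * p) ≡ p * (y * y * p)
    ring = solve-∀
  descend (suc k) p∣x² eq | divides y refl =
    p^odd*M-nonsquare p-prime p∤M k y (*-cancelˡ-≡ _ _ p (*-cancelˡ-≡ _ _ p (begin
    p * (p * (y * y))                  ≡⟨ ring₁ y p ⟩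
    y * p * (y * p)                    ≡⟨ eq ⟩
    p ^ (2 * suc k + 1) * M            ≡⟨ cong (λ e → p ^ e * M) (ring₂ k) ⟩
    p * (p * p ^ (2 * k + 1)) * M      ≡⟨ ring₃ p (p ^ (2 * k + 1)) M ⟩
    p * (p * (p ^ (2 * k + 1) * M))    ∎)))
    where
    ring₁ : ∀ y p → p * (p * (y * y)) ≡ y * p * (y * p)
    ring₁ = solve-∀
    ring₂ : ∀ k → 2 * suc k + 1 ≡ 2 + (2 * k + 1)
    ring₂ = solve-∀
    ring₃ : ∀ p q M → p * (p * q) * M ≡ p * (p * (q * M))
    ring₃ = solve-∀

odd-^ : ∀ {p} → 2 ∤ p → ∀ e → 2 ∤ p ^ e
odd-^     2∤p zero    2∣1 = from-no (2 ∣? 1) 2∣1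
odd-^ {p} 2∤p (suc e) 2∣p^ = [ 2∤p , odd-^ 2∤p e ]′ (euclidsLemma p (p ^ e) prime[2] 2∣p^)

odd⇒ā≡B : ∀ s {N} → 2 ∤ N → ā s N ≡ B s N N
odd⇒ā≡B s {zero}  2∤0 = contradiction (2 ∣0) 2∤0
odd⇒ā≡B s {suc n} _   = ā-suc≡B s n

-- The two congruences

-- At odd `N` only 2^(m+2) `u` remains, and `u` is even because a nonsquare has an even number of
-- divisors.
ā-2^*-odd-nonsquare : ∀ m α {N} → 2 ∤ N → (∀ x → x * x ≢ N) → 2 ^ (3 + m) ∣ ā (2 ^ suc m * α) N
ā-2^*-odd-nonsquare m α {N} 2∤N nonsquare
  with B-2^*-mod m α N | divisors-even N nonsquare
... | e , u , eq , e-even , _ , u≡ | d , D≡ with u≡ N 2∤N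
... | r , u≡ₙ = divides (α * d + r) (begin
  ā S N                                        ≡⟨ odd⇒ā≡B S 2∤N ⟩
  B S N N                                      ≡⟨ eq N ⟩
  e N + Q * u N                                ≡⟨ cong₂ (λ x y → x + Q * y) (e-even N 2∤N) u≡ₙ ⟩
  Q * (α * ∑ N (λ i → X (suc i) δ N) + 2 * r)  ≡⟨ cong (λ x → Q * (α * x + 2 * r)) D≡ ⟩
  Q * (α * (2 * d) + 2 * r)                    ≡⟨ ring Q α d r ⟩
  (α * d + r) * 2 ^ (3 + m)                    ∎)
  where
  open ≡-Reasoning
  S Q : ℕ
  S = 2 ^ suc m * α
  Q = 2 ^ (2 + m)
  ring : ∀ Q α d r → Q * (α * (2 * d) + 2 * r) ≡ (α * d + r) * (2 * Q)
  ring = solve-∀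

ā-odd-odd-nonsquare : ∀ β {N} → 2 ∤ N → (∀ x → x * x ≢ N) → 4 ∣ ā (2 * β + 1) N
ā-odd-odd-nonsquare β {N} 2∤N nonsquare with B-odd-mod-4 β N | divisors-even N nonsquare
... | v , eq | d , D≡ = divides (d + v N) (begin
  ā (2 * β + 1) N
    ≡⟨ odd⇒ā≡B (2 * β + 1) 2∤N ⟩
  B (2 * β + 1) N N
    ≡⟨ eq N ⟩
  δ N + 2 * (∑ N (λ i → X (suc i) δ N) + 2 * v N)
    ≡⟨ cong₂ (λ x y → x + 2 * (y + 2 * v N)) (δ-even N 2∤N) D≡ ⟩
  2 * (2 * d + 2 * v N)
    ≡⟨ ring d (v N) ⟩
  (d + v N) * 4 ∎)
  where
  open ≡-Reasoning
  ring : ∀ d v → 2 * (2 * d + 2 * v) ≡ (d + v) * 4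
  ring = solve-∀

theorem1p6 : ∀ (p m α β : ℕ) → Prime p → p ≥ 5 → p % 4 ≡ 3 →
    m ≥ 1 → α ≥ 1 → β ≥ 1 → 2 ∤ α →
    ∀ (n k : ℕ) → p ∤ n →
    (2 ^ (m + 2) ∣ ā (2 ^ m * α) (4 * p ^ (2 * k + 1) * n + p ^ (2 * k + 2)))
    × (4 ∣ ā (2 * β + 1) (4 * p ^ (2 * k + 1) * n + p ^ (2 * k + 2)))
theorem1p6 p (suc m) α β p-prime p≥5 p%4≡3 _ _ _ _ n k p∤n =
    subst (λ e → 2 ^ e ∣ ā (2 ^ suc m * α) N) (+-comm 2 (suc m))
      (ā-2^*-odd-nonsquare m α 2∤N nonsquare)
  , ā-odd-odd-nonsquare β 2∤N nonsquare
  where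
  N P : ℕ
  N = 4 * p ^ (2 * k + 1) * n + p ^ (2 * k + 2)
  P = p ^ (2 * k + 1)
  2∤p : 2 ∤ p
  2∤p 2∣p = from-no (2 ∣? 3) (∣m+n∣m⇒∣n (subst (2 ∣_) p≡ 2∣p) (∣n⇒∣m*n (p / 4) (divides 2 refl)))
    where
    p≡ : p ≡ p / 4 * 4 + 3
    p≡ = trans (m≡m%n+[m/n]*n p 4)
      (trans (cong (_+ p / 4 * 4) p%4≡3) (+-comm 3 (p / 4 * 4)))
  2∤N : 2 ∤ N
  2∤N 2∣N = odd-^ 2∤p (2 * k + 2)
    (∣m+n∣m⇒∣n 2∣N (∣m⇒∣m*n n (∣m⇒∣m*n P (divides 2 refl))))
  -- A divisor `p` of 4n + p divides 4n, hence 4 or `n`; the first fails since `p ≥ 5`.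
  p∤4n+p : p ∤ 4 * n + p
  p∤4n+p p∣4n+p = [ (λ p∣4 → <⇒≱ p≥5 (∣⇒≤ p∣4)) , p∤n ]′
    (euclidsLemma 4 n p-prime (∣m+n∣m⇒∣n (subst (p ∣_) (+-comm (4 * n) p) p∣4n+p) ∣-refl))
  N≡ : N ≡ P * (4 * n + p)
  N≡ = trans (cong (λ e → 4 * P * n + p ^ e) (+-suc (2 * k) 1)) (ring P n p)
    where
    ring : ∀ P n p → 4 * P * n + p * P ≡ P * (4 * n + p)
    ring = solve-∀
  nonsquare : ∀ x → x * x ≢ N
  nonsquare x x²≡N = p^odd*M-nonsquare p-prime p∤4n+p k x (trans x²≡N N≡)
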